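{- Let $k\ge1$ and $n$ be positive integers. Let $\Gamma(m)$ denote the least common multiple of $1,2,\dots,m$, and define $m_1=m_2=1$, $m_3=2$ and $m_{i+1}=2m_i(m_i-1)\Gamma(2m_i-1)$ for $i\ge3$. If $4m_{2k}$ divides $n$, then there does not exist a set of $k$-maxMOFS$(n;n/2)$.
   Context: A frequency square of type $(n;\lambda)$ is an $n\times n$ array on symbols $\{0,\dots,n/\lambda-1\}$ in which each symbol occurs $\lambda$ times in each row and each column. Two such squares are orthogonal if, when superimposed, each ordered pair of symbols occurs $\lambda^2$ times. A set of $k$-maxMOFS$(n;\lambda)$ is a set of $k$ pairwise orthogonal frequency squares of type $(n;\lambda)$ such that no frequency square of type $(n;\lambda)$ is orthogonal to all of them. -}

module Defs where

open import Data.Nat using (ℕ; zero; suc; _+_; _*_; _∸_; _/_; NonZero)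
open import Data.Nat.LCM using (lcm)
open import Data.Fin using (Fin; zero; suc; _≟_)
open import Data.Bool using (Bool; true; false; _∧_)
open import Relation.Nullary.Decidable using (⌊_⌋)
open import Relation.Binary.PropositionalEquality using (_≡_; _≢_)
open import Relation.Nullary using (¬_)
open import Data.Product using (Σ; _×_)

Γ : ℕ → ℕ
Γ zero    = 1
Γ (suc m) = lcm (suc m) (Γ m)

-- the sequence m_i (index i ≥ 1); mseq 0 is an unused dummy value
mseq : ℕ → ℕ
mseq zero = 1
mseq (suc zero) = 1
mseq (suc (suc zero)) = 1
mseq (suc (suc (suc zero))) = 2
mseq (suc (suc (suc (suc i)))) =
  let a = mseq (suc (suc (suc i))) in 2 * a * (a ∸ 1) * Γ (2 * a ∸ 1)

count : ∀ {n} → (Fin n → Bool) → ℕ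
count {zero}  p = 0
count {suc n} p with p zero
... | true  = suc (count (λ i → p (suc i)))
... | false = count (λ i → p (suc i))

count2 : ∀ {r c} → (Fin r → Fin c → Bool) → ℕ
count2 {zero}  p = 0
count2 {suc r} p = count (p zero) + count2 (λ i → p (suc i))

Square : ℕ → ℕ → Set
Square n d = Fin n → Fin n → Fin d

FSq : (n l : ℕ) .{{_ : NonZero l}} → Set
FSq n l = Square n (n / l)

IsFreqSquare : (n l : ℕ) .{{_ : NonZero l}} → FSq n l → Set
IsFreqSquare n l L =
  (∀ (s : Fin (n / l)) (i : Fin n) → count (λ j → ⌊ L i j ≟ s ⌋) ≡ l) ×
  (∀ (s : Fin (n / l)) (j : Fin n) → count (λ i → ⌊ L i j ≟ s ⌋) ≡ l)

Orthogonal : (n l : ℕ) .{{_ : NonZero l}} → FSq n l → FSq n l → Set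
Orthogonal n l L M =
  ∀ (s t : Fin (n / l)) →
    count2 (λ i j → ⌊ L i j ≟ s ⌋ ∧ ⌊ M i j ≟ t ⌋)
    ≡ l * l

IsMaxMOFS : (k n l : ℕ) .{{_ : NonZero l}} → (Fin k → FSq n l) → Set
IsMaxMOFS k n l F =
  (∀ a → IsFreqSquare n l (F a)) ×
  (∀ a b → a ≢ b → Orthogonal n l (F a) (F b)) ×
  ¬ (Σ (FSq n l) (λ L → IsFreqSquare n l L × (∀ a → Orthogonal n l L (F a))))

ExistsMaxMOFS : (k n l : ℕ) .{{_ : NonZero l}} → Set
ExistsMaxMOFS k n l = Σ (Fin k → FSq n l) (IsMaxMOFS k n l)

{-# OPTIONS --safe #-}

-- Pair column c with column c + λ.  For fixed c let w_a(i) ∈ {-1,0,1} be the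
-- difference of the indicators of symbol 0 in row i of the two columns of F_a;
-- then Σ_i w_a(i) = 0 for every a.  If half of the rows, R_c, also satisfy
-- Σ_{i ∈ R_c} w_a(i) = 0 for every a, then the square with 0 on R_c in column c,
-- 1 on R_c in column c + λ, and the opposite symbols elsewhere is orthogonal to all F_a.
--
-- To find R_c, a zero-sum family of vectors in {-1,0,1}^k is decomposed into zero-sum
-- blocks of length at most D, where D(1) = 2, D(2) = 4 and D(k+1) = 2 D(k)² for k ≥ 2.
-- As long as more than D (Γ(D) - 1) vectors are left, some length i ≤ D occurs Γ(D)/i
-- times among the blocks, which gives a zero-sum subfamily with exactly Γ(D) members.
-- Since 2 m_{2k} is a multiple q Γ(D) with q ≥ D - 1, half of the rows can be collected in
-- this way.

module Submission where

open import Defs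
open import Algebra.Bundles using (module AbelianGroup)
import Algebra.Properties.CommutativeMonoid.Sum
import Algebra.Properties.CommutativeSemigroup
import Algebra.Properties.Group
open import Data.Bool using (Bool; true; false; not; _∧_; _∨_)
open import Data.Bool.Properties using (∧-identityʳ; not-involutive)
open import Data.Fin as Fin using (Fin; zero; suc; _↑ˡ_; _↑ʳ_; splitAt)
import Data.Fin.Properties as Fin
open import Data.Integer as ℤ using (ℤ; +_; -[1+_]; 0ℤ; 1ℤ; -1ℤ; ∣_∣)
import Data.Integer.Properties as ℤ
open import Data.Integer.Tactic.RingSolver using (solve-∀)
open import Data.List
  using (List; []; _∷_; _++_; map; concat; length; lookup; [_]; filter; take; drop; tabulate; allFin)
import Data.List.Membership.DecPropositional as DecMembership
open import Data.List.Membership.Propositional using (_∈_; _∉_)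
open import Data.List.Membership.Propositional.Properties using (∈-lookup)
import Data.List.Properties as List
open import Data.List.Relation.Binary.Permutation.Propositional as Perm
  using (_↭_; prep; swap; ↭-refl; ↭-reflexive; ↭-sym; ↭-trans; ↭⇒↭ₛ)
import Data.List.Relation.Binary.Permutation.Propositional.Properties as Perm
import Data.List.Relation.Binary.Permutation.Setoid.Properties as PermSetoid
open import Data.List.Relation.Unary.All as All using (All; []; _∷_)
import Data.List.Relation.Unary.All.Properties as All
open import Data.List.Relation.Unary.AllPairs using ([]; _∷_)
open import Data.List.Relation.Unary.Any using (here; there)
open import Data.List.Relation.Unary.Unique.Propositional using (Unique)
open import Data.List.Relation.Unary.Unique.Propositional.Properties using (allFin⁺)
open import Data.Nat as ℕ using (zero; suc; s≤s; z≤n; _∸_)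
open import Data.Nat using (ℕ; _*_; _≤_; _<_; NonZero)
open import Data.Nat.Divisibility using (_∣_)
open import Data.Nat.Divisibility using (divides; ∣⇒≤; ∣-trans; 1∣_; *-cancelˡ-∣)
open import Data.Nat.DivMod using (m*n/n≡m)
open import Data.Nat.GCD using (gcd)
open import Data.Nat.LCM using (m∣lcm[m,n]; n∣lcm[m,n]; lcm-least; gcd*lcm)
import Data.Nat.Properties as ℕ
open import Data.Product using (∃; ∃₂; _×_; _,_; proj₁; proj₂)
open import Data.Sum using (_⊎_; inj₁; inj₂; [_,_]′)
open import Function using (_∘_)
open import Function.Definitions using (Injective)
open import Level using (0ℓ)
open import Relation.Binary.PropositionalEquality using (_≡_)
open import Relation.Binary.PropositionalEquality using (_≢_; _≗_; refl; sym; trans; cong; cong₂; subst; setoid)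
open import Relation.Nullary using (¬_)
open import Relation.Nullary using (Dec; yes; no; contradiction)
open import Relation.Nullary.Decidable using (⌊_⌋)
open import Relation.Unary using (Pred; Decidable)
open import Relation.Unary.Properties using (∁?)

open Algebra.Properties.CommutativeMonoid.Sum ℕ.+-0-commutativeMonoid using (sum; ∑-comm)
open Algebra.Properties.CommutativeSemigroup ℕ.+-commutativeSemigroup using (interchange)
open Algebra.Properties.Group (AbelianGroup.group ℤ.+-0-abelianGroup) using () renaming (∙-cancelˡ to +-cancelˡ)
open DecMembership ℤ._≟_ using (_∈?_)

private variable
  A B : Set
  m n : ℕ

-- Integer sums over lists and their invariance under permutation

∑ : (A → ℤ) → List A → ℤ
∑ w []      = 0ℤ
∑ w (x ∷ l) = w x ℤ.+ ∑ w l

∑-++ : (w : A → ℤ) (l l′ : List A) → ∑ w (l ++ l′) ≡ ∑ w l ℤ.+ ∑ w l′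
∑-++ w []      l′ = sym (ℤ.+-identityˡ _)
∑-++ w (x ∷ l) l′ = trans (cong (λ z → w x ℤ.+ z) (∑-++ w l l′)) (sym (ℤ.+-assoc (w x) _ _))

∑-concat : (w : A → ℤ) (bs : List (List A)) → ∑ w (concat bs) ≡ ∑ (∑ w) bs
∑-concat w []       = refl
∑-concat w (b ∷ bs) = trans (∑-++ w b (concat bs)) (cong (λ z → ∑ w b ℤ.+ z) (∑-concat w bs))

∑-↭ : (w : A → ℤ) {l l′ : List A} → l ↭ l′ → ∑ w l ≡ ∑ w l′
∑-↭ w Perm.refl        = refl
∑-↭ w (prep x p)       = cong (λ z → w x ℤ.+ z) (∑-↭ w p)
∑-↭ w (swap {l} x y p) = trans (swap-sum (w x) (w y) (∑ w l)) (cong (λ s → w y ℤ.+ (w x ℤ.+ s)) (∑-↭ w p))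
  where
  swap-sum : ∀ a b c → a ℤ.+ (b ℤ.+ c) ≡ b ℤ.+ (a ℤ.+ c)
  swap-sum = solve-∀
∑-↭ w (Perm.trans p q) = trans (∑-↭ w p) (∑-↭ w q)

∑-zero : (w : A → ℤ) {l : List A} → All (λ x → w x ≡ 0ℤ) l → ∑ w l ≡ 0ℤ
∑-zero w []       = refl
∑-zero w (e ∷ es) = cong₂ ℤ._+_ e (∑-zero w es)

∑-rest : (w : A → ℤ) {c r l : List A} → c ++ r ↭ l → ∑ w c ≡ 0ℤ → ∑ w l ≡ 0ℤ → ∑ w r ≡ 0ℤ
∑-rest w {c} {r} q ec el = trans (sym (ℤ.+-identityˡ _)) (trans (cong (ℤ._+ ∑ w r) (sym ec))
  (trans (sym (∑-++ w c r)) (trans (∑-↭ w q) el)))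

∣∑∣≤length : (w : A → ℤ) {l : List A} → All (λ x → ∣ w x ∣ ≤ 1) l → ∣ ∑ w l ∣ ≤ length l
∣∑∣≤length w [] = z≤n
∣∑∣≤length w {x ∷ l} (p ∷ ps) =
  ℕ.≤-trans (ℤ.∣i+j∣≤∣i∣+∣j∣ (w x) (∑ w l)) (ℕ.+-mono-≤ p (∣∑∣≤length w ps))

concat-↭ : {bs cs : List (List A)} → bs ↭ cs → concat bs ↭ concat cs
concat-↭ Perm.refl        = ↭-refl
concat-↭ (prep b p)       = Perm.++⁺ˡ b (concat-↭ p)
concat-↭ (swap b c p)     = ↭-trans (Perm.shifts b c) (Perm.++⁺ˡ c (Perm.++⁺ˡ b (concat-↭ p)))
concat-↭ (Perm.trans p q) = ↭-trans (concat-↭ p) (concat-↭ q)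

-- Zero-sum blocks in dimension one: partial sums in a window, loop erasure

pick-≥0 : (w : A → ℤ) (x : A) (l : List A) → 0ℤ ℤ.≤ ∑ w (x ∷ l) →
          ∃₂ λ y r → x ∷ l ↭ y ∷ r × 0ℤ ℤ.≤ w y
pick-≥0 w x l h with 0ℤ ℤ.≤? w x
... | yes p = x , l , ↭-refl , p
pick-≥0 w x [] h | no p = contradiction (subst (0ℤ ℤ.≤_) (ℤ.+-identityʳ (w x)) h) p
pick-≥0 w x (x′ ∷ l) h | no p =
  -- The head is negative, so dropping it only raises the sum.
  let rest = subst (w x ℤ.+ ∑ w (x′ ∷ l) ℤ.≤_) (ℤ.+-identityˡ _)
               (ℤ.+-monoˡ-≤ (∑ w (x′ ∷ l)) (ℤ.<⇒≤ (ℤ.≰⇒> p)))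
      y , r , q , c = pick-≥0 w x′ l (ℤ.≤-trans h rest)
  in y , x ∷ r , ↭-trans (prep x q) (swap x y ↭-refl) , c

pick-<0 : (w : A → ℤ) (l : List A) → ∑ w l ℤ.< 0ℤ →
          ∃₂ λ y r → l ↭ y ∷ r × w y ℤ.< 0ℤ
pick-<0 w [] (ℤ.+<+ ())
pick-<0 w (x ∷ l) h with w x ℤ.<? 0ℤ
... | yes p = x , l , ↭-refl , p
... | no p =
  let rest = subst (ℤ._≤ w x ℤ.+ ∑ w l) (ℤ.+-identityˡ _) (ℤ.+-monoˡ-≤ (∑ w l) (ℤ.≮⇒≥ p))
      y , r , q , c = pick-<0 w l (ℤ.≤-<-trans rest h)
  in y , x ∷ r , ↭-trans (prep x q) (swap x y ↭-refl) , c

-- Open below and closed above, so that the window holds exactly `M + M` integers; this number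
-- becomes the bound on loop lengths.
InWindow : ℕ → ℤ → Set
InWindow M s = ℤ.- (+ M) ℤ.< s × s ℤ.≤ + M

private
  abs≤⇒≤ : ∀ x {M} → ∣ x ∣ ≤ M → x ℤ.≤ + M
  abs≤⇒≤ (+ m)    p = ℤ.+≤+ p
  abs≤⇒≤ -[1+ m ] p = ℤ.-≤+

  abs≤⇒-≤ : ∀ x {M} → ∣ x ∣ ≤ M → ℤ.- (+ M) ℤ.≤ x
  abs≤⇒-≤ (+ m)    p = ℤ.neg-≤-pos
  abs≤⇒-≤ -[1+ m ] p = ℤ.neg-mono-≤ (ℤ.+≤+ p)

window-up : ∀ {M s x} → InWindow M s → s ℤ.≤ 0ℤ → 0ℤ ℤ.≤ x → ∣ x ∣ ≤ M → InWindow M (s ℤ.+ x)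
window-up {M} {s} {x} (lo , hi) s≤0 0≤x b =
  ℤ.<-≤-trans lo (subst (ℤ._≤ s ℤ.+ x) (ℤ.+-identityʳ s) (ℤ.+-monoʳ-≤ s 0≤x)) ,
  ℤ.≤-trans (subst (s ℤ.+ x ℤ.≤_) (ℤ.+-identityˡ x) (ℤ.+-monoˡ-≤ x s≤0)) (abs≤⇒≤ x b)

-- The bound `x ≥ -M` is not strict; `0 < s` supplies the strictness that the open end of the window
-- asks for.
window-down : ∀ {M s x} → InWindow M s → 0ℤ ℤ.< s → x ℤ.< 0ℤ → ∣ x ∣ ≤ M → InWindow M (s ℤ.+ x)
window-down {M} {s} {x} (lo , hi) 0<s x<0 b =
  ℤ.≤-<-trans (abs≤⇒-≤ x b) (subst (ℤ._< s ℤ.+ x) (ℤ.+-identityˡ x) (ℤ.+-monoˡ-< x 0<s)) ,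
  ℤ.≤-trans (ℤ.<⇒≤ (subst (s ℤ.+ x ℤ.<_) (ℤ.+-identityʳ s) (ℤ.+-monoʳ-< s x<0))) hi

-- The reflection of `s` to `M - s` carries the window to the numbers from 0 to `2M - 1`, which
-- serve as pigeonholes.
window-index-< : ∀ {M s} → InWindow M s → ∣ + M ℤ.- s ∣ < M ℕ.+ M
window-index-< {M} {s} (lo , hi) = ℤ.drop‿+<+
  (subst (ℤ._< + (M ℕ.+ M)) (sym (ℤ.0≤i⇒+∣i∣≡i (ℤ.i≤j⇒0≤j-i hi)))
    (ℤ.+-monoʳ-< (+ M) (subst (ℤ.- s ℤ.<_) (ℤ.neg-involutive (+ M)) (ℤ.neg-mono-< lo))))

window-index-injective : ∀ {M s t} → InWindow M s → InWindow M t →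
                         ∣ + M ℤ.- s ∣ ≡ ∣ + M ℤ.- t ∣ → s ≡ t
window-index-injective {M} {s} {t} (_ , hs) (_ , ht) e = ℤ.neg-injective (+-cancelˡ (+ M) _ _
  (trans (sym (ℤ.0≤i⇒+∣i∣≡i (ℤ.i≤j⇒0≤j-i hs)))
    (trans (cong +_ e) (ℤ.0≤i⇒+∣i∣≡i (ℤ.i≤j⇒0≤j-i ht)))))

lookup-injective : {l : List A} → Unique l → Injective _≡_ _≡_ (lookup l)
lookup-injective (n ∷ u) {zero}  {zero}  e = refl
lookup-injective (n ∷ u) {zero}  {suc j} e = contradiction e (All.lookup n (∈-lookup j))
lookup-injective (n ∷ u) {suc i} {zero}  e = contradiction (sym e) (All.lookup n (∈-lookup i))
lookup-injective (n ∷ u) {suc i} {suc j} e = cong suc (lookup-injective u e)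

window-pigeonhole : ∀ {M} {l : List ℤ} → Unique l → All (InWindow M) l → length l ≤ M ℕ.+ M
window-pigeonhole {M} {l} u ws = Fin.injective⇒≤ {f = index} λ {i} {j} e →
  lookup-injective u (window-index-injective (inWindow i) (inWindow j)
    (trans (sym (Fin.toℕ-fromℕ< _)) (trans (cong Fin.toℕ e) (Fin.toℕ-fromℕ< _))))
  where
  inWindow : ∀ i → InWindow M (lookup l i)
  inWindow i = All.lookup ws (∈-lookup i)
  index : Fin (length l) → Fin (M ℕ.+ M)
  index i = Fin.fromℕ< (window-index-< (inWindow i))

visits : (A → ℤ) → ℤ → List A → List ℤ
visits w s []      = s ∷ []
visits w s (x ∷ p) = s ∷ visits w (s ℤ.+ w x) p

end∈visits : (w : A → ℤ) (s : ℤ) (p : List A) → s ℤ.+ ∑ w p ∈ visits w s p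
end∈visits w s []      = here (ℤ.+-identityʳ s)
end∈visits w s (x ∷ p) = there
  (subst (_∈ visits w (s ℤ.+ w x) p) (ℤ.+-assoc s (w x) _) (end∈visits w (s ℤ.+ w x) p))

length-visits : (w : A → ℤ) (s : ℤ) (p : List A) → length (visits w s p) ≡ suc (length p)
length-visits w s []      = refl
length-visits w s (x ∷ p) = cong suc (length-visits w _ p)

SimplePath : ℕ → (A → ℤ) → ℤ → List A → Set
SimplePath M w s p = Unique (visits w s p) × All (InWindow M) (visits w s p)

cut : ∀ {M} (w : A → ℤ) t p {s} → s ∈ visits w t p → SimplePath M w t p →
      ∃₂ λ p₁ p₂ → p ≡ p₁ ++ p₂ × t ℤ.+ ∑ w p₁ ≡ s × SimplePath M w s p₂
cut w t []      (here refl) sp = [] , [] , refl , ℤ.+-identityʳ t , sp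
cut w t (x ∷ p) (here refl) sp = [] , x ∷ p , refl , ℤ.+-identityʳ t , sp
cut w t (x ∷ p) (there m) (_ ∷ u , _ ∷ ws)
  with p₁ , p₂ , e , f , sp ← cut w (t ℤ.+ w x) p m (u , ws)
  = x ∷ p₁ , p₂ , cong (x ∷_) e , trans (sym (ℤ.+-assoc t (w x) _)) f , sp

ZeroSumBlocks : ℕ → (A → ℤ) → List (List A) → Set
ZeroSumBlocks D w = All (λ b → length b ≤ D × ∑ w b ≡ 0ℤ)

-- Loop erasure of a walk on the integers that starts at `s`. The order of the items is free, so the
-- pieces only have to form a permutation of `l`.
LoopErasure : ℕ → (A → ℤ) → ℤ → List A → Set
LoopErasure M w s l = ∃₂ λ loops path →
  concat loops ++ path ↭ l × ZeroSumBlocks (M ℕ.+ M) w loops × SimplePath M w s path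

-- If the path never returns to `s`, it is extended by `x`. Otherwise `x` and the items before the
-- return form a zero-sum loop, which is split off.
prepend : ∀ {M} (w : A → ℤ) {s x l} → InWindow M s →
          LoopErasure M w (s ℤ.+ w x) l → LoopErasure M w s (x ∷ l)
prepend {M = M} w {s} {x} sw (loops , p , perm , ok , sp@(u , ws)) with s ∈? visits w (s ℤ.+ w x) p
... | no s∉ =
  loops , x ∷ p , ↭-trans (Perm.shift x (concat loops) p) (prep x perm) , ok ,
  All.¬Any⇒All¬ _ s∉ ∷ u , sw ∷ ws
... | yes s∈ with p₁ , p₂ , refl , e , sp₂ ← cut w (s ℤ.+ w x) p s∈ sp =
  (x ∷ p₁) ∷ loops , p₂ ,
  prep x (↭-trans (↭-reflexive (List.++-assoc p₁ (concat loops) p₂))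
           (↭-trans (Perm.shifts p₁ (concat loops)) perm)) ,
  (short , closed) ∷ ok , sp₂
  where
  -- The visits of the old path are distinct window values and outnumber its items by one; this one
  -- makes room for `x`.
  short : suc (length p₁) ≤ M ℕ.+ M
  short = ℕ.≤-trans (s≤s (subst (length p₁ ≤_) (sym (List.length-++ p₁)) (ℕ.m≤m+n _ _)))
            (subst (_≤ M ℕ.+ M) (length-visits w (s ℤ.+ w x) (p₁ ++ p₂)) (window-pigeonhole u ws))
  closed : w x ℤ.+ ∑ w p₁ ≡ 0ℤ
  closed = +-cancelˡ s _ _
    (trans (sym (ℤ.+-assoc s (w x) _)) (trans e (sym (ℤ.+-identityʳ s))))

-- The next item is chosen of sign opposite to the current partial sum, so that
-- all partial sums stay in the window.
walk : ∀ {M} (w : A → ℤ) n l s → length l ≡ n → All (λ x → ∣ w x ∣ ≤ M) l →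
       InWindow M s → s ℤ.+ ∑ w l ≡ 0ℤ → LoopErasure M w s l
walk w n [] s _ bd sw e = [] , [] , ↭-refl , [] , [] ∷ [] , sw ∷ []
walk {M = M} w (suc n) (x ∷ l) s len bd sw e = body
  where
  continue : ∀ {y r} → x ∷ l ↭ y ∷ r → (∣ w y ∣ ≤ M → InWindow M (s ℤ.+ w y)) →
             LoopErasure M w s (x ∷ l)
  continue {y} {r} q next with by ∷ br ← Perm.All-resp-↭ q bd
    with loops , p , perm , rest ← prepend w {x = y} sw
      (walk w n r (s ℤ.+ w y) (ℕ.suc-injective (trans (sym (Perm.↭-length q)) len)) br (next by)
        (trans (ℤ.+-assoc s (w y) _) (trans (cong (λ z → s ℤ.+ z) (sym (∑-↭ w q))) e)))
    = loops , p , ↭-trans perm (↭-sym q) , rest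
  ∑≡-s : ∑ w (x ∷ l) ≡ ℤ.- s
  ∑≡-s = +-cancelˡ s _ _ (trans e (sym (ℤ.+-inverseʳ s)))
  body : LoopErasure M w s (x ∷ l)
  body with s ℤ.≤? 0ℤ
  ... | yes s≤0 with y , r , q , c ← pick-≥0 w x l (subst (0ℤ ℤ.≤_) (sym ∑≡-s) (ℤ.neg-mono-≤ s≤0)) =
    continue q (window-up sw s≤0 c)
  ... | no s≰0 with y , r , q , c ← pick-<0 w (x ∷ l) (subst (ℤ._< 0ℤ) (sym ∑≡-s) (ℤ.neg-mono-< (ℤ.≰⇒> s≰0))) =
    continue q (window-down sw (ℤ.≰⇒> s≰0) c)

-- A nonempty path with sum zero would visit its starting value twice.
simple-closed : ∀ {M} (w : A → ℤ) p → SimplePath M w 0ℤ p → ∑ w p ≡ 0ℤ → p ≡ []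
simple-closed w []      _           e = refl
simple-closed w (x ∷ p) (n ∷ _ , _) e = contradiction
  (sym (trans (ℤ.+-assoc 0ℤ (w x) (∑ w p)) (trans (ℤ.+-identityˡ _) e)))
  (All.lookup n (end∈visits w (0ℤ ℤ.+ w x) p))

-- The walk starts at 0, which lies in the window because `1 ≤ M`. The loops have sum zero, hence so
-- does the path that is left, and a closed simple path is empty.
zero-sum-blocks : ∀ {M} (w : A → ℤ) l → 1 ≤ M → All (λ x → ∣ w x ∣ ≤ M) l → ∑ w l ≡ 0ℤ →
                  ∃ λ bs → concat bs ↭ l × ZeroSumBlocks (M ℕ.+ M) w bs
zero-sum-blocks w l (s≤s z≤n) bd e
  with loops , p , perm , ok , sp ← walk w _ l 0ℤ refl bd (ℤ.-<+ , ℤ.+≤+ z≤n) (trans (ℤ.+-identityˡ _) e)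
  with refl ← simple-closed w p sp
    (∑-rest w {concat loops} perm (trans (∑-concat w loops) (∑-zero (∑ w) (All.map proj₂ ok))) e)
  = loops , ↭-trans (↭-sym (Perm.++-identityʳ _)) perm , ok

-- Zero-sum blocks in higher dimension

-- Equivalently, `D` bounds the length of every minimal zero-sum sequence of vectors with `k`
-- entries of absolute value at most 1: a Davenport constant.
Decomposable : ℕ → ℕ → Set₁
Decomposable k D = ∀ {A : Set} (w : Fin k → A → ℤ) l →
  (∀ a → All (λ x → ∣ w a x ∣ ≤ 1) l) → (∀ a → ∑ (w a) l ≡ 0ℤ) →
  ∃ λ bs → concat bs ↭ l × All (λ b → length b ≤ D × (∀ a → ∑ (w a) b ≡ 0ℤ)) bs

-- Without coordinates singletons already have zero sum; one use of `decomposable-suc` then gives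
-- `D(1) = 2`.
decomposable-zero : Decomposable 0 1
decomposable-zero w l _ _ =
  map [_] l , ↭-reflexive (List.concat-map-[ l ]) , All.map⁺ (All.universal (λ _ → s≤s z≤n , λ ()) l)

length-concat-≤ : ∀ {D} {bs : List (List A)} → All (λ b → length b ≤ D) bs →
                  length (concat bs) ≤ length bs * D
length-concat-≤ [] = z≤n
length-concat-≤ {bs = b ∷ bs} (p ∷ ps) =
  subst (_≤ _) (sym (List.length-++ b)) (ℕ.+-mono-≤ p (length-concat-≤ ps))

-- The blocks for the last k coordinates become the items of a one-dimensional
-- problem for coordinate zero.
decomposable-suc : ∀ {k D} → 1 ≤ D → Decomposable k D → Decomposable (suc k) ((D ℕ.+ D) * D)
decomposable-suc {k} {D} 1≤D dec w l bd e
  with bs , perm , ok ← dec (w ∘ suc) l (bd ∘ suc) (e ∘ suc)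
  with cs , perm′ , ok′ ← zero-sum-blocks (∑ (w zero)) bs 1≤D
    (All.zipWith (λ (p , q) → ℕ.≤-trans (∣∑∣≤length (w zero) p) (proj₁ q))
      (All.concat⁻ (Perm.All-resp-↭ (↭-sym perm) (bd zero)) , ok))
    (trans (sym (∑-concat (w zero) bs)) (trans (∑-↭ (w zero) perm) (e zero)))
  = map concat cs ,
    ↭-trans (↭-reflexive (List.concat-concat cs)) (↭-trans (concat-↭ perm′) perm) ,
    All.map⁺ (All.zipWith merge (ok′ , All.concat⁻ (Perm.All-resp-↭ (↭-sym perm′) ok)))
  where
  merge : ∀ {c} → (length c ≤ D ℕ.+ D × ∑ (∑ (w zero)) c ≡ 0ℤ) ×
          All (λ b → length b ≤ D × (∀ a → ∑ (w (suc a)) b ≡ 0ℤ)) c →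
          length (concat c) ≤ (D ℕ.+ D) * D × (∀ a → ∑ (w a) (concat c) ≡ 0ℤ)
  merge {c} ((len , z) , ok) =
    ℕ.≤-trans (length-concat-≤ (All.map proj₁ ok)) (ℕ.*-monoˡ-≤ D len) , λ where
      zero    → trans (∑-concat (w zero) c) z
      (suc a) → trans (∑-concat (w (suc a)) c) (∑-zero _ (All.map (λ q → proj₂ q a) ok))

-- Dimension two: blocks of at most four vectors by exhaustive search

∑-neg : (w : A → ℤ) (l : List A) → ∑ (λ x → ℤ.- w x) l ≡ ℤ.- ∑ w l
∑-neg w []      = refl
∑-neg w (x ∷ l) = trans (cong (λ z → ℤ.- w x ℤ.+ z) (∑-neg w l)) (sym (ℤ.neg-distrib-+ (w x) (∑ w l)))

opposite : ℤ → ℤ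
opposite (+ zero)  = 0ℤ
opposite (+ suc _) = -1ℤ
opposite -[1+ _ ]  = 1ℤ

private
  unit-<0 : ∀ x → ∣ x ∣ ≤ 1 → x ℤ.< 0ℤ → x ≡ -1ℤ
  unit-<0 -[1+ zero ]  _        _            = refl
  unit-<0 -[1+ suc _ ] (s≤s ()) _
  unit-<0 (+ _)        _        (ℤ.+<+ ())

  unit->0 : ∀ x → ∣ x ∣ ≤ 1 → ℤ.- x ℤ.< 0ℤ → x ≡ 1ℤ
  unit->0 (+ suc zero)    _        _ = refl
  unit->0 (+ suc (suc _)) (s≤s ()) _
  unit->0 (+ zero)        _        (ℤ.+<+ ())
  unit->0 -[1+ _ ]        _        (ℤ.+<+ ())

-- The sum over `l` is `-s`, so some item has its sign, and an entry of absolute value at most 1 is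
-- determined by a nonzero sign.
pick-opposite : (w : A → ℤ) (l : List A) → All (λ x → ∣ w x ∣ ≤ 1) l → ∀ s → s ≢ 0ℤ → s ℤ.+ ∑ w l ≡ 0ℤ →
                ∃₂ λ y r → l ↭ y ∷ r × w y ≡ opposite s
pick-opposite w l bd s s≢0 e with +-cancelˡ s (∑ w l) (ℤ.- s) (trans e (sym (ℤ.+-inverseʳ s)))
pick-opposite w l bd (+ zero)  s≢0 e | _ = contradiction refl s≢0
pick-opposite w l bd (+ suc n) s≢0 e | f
  with y , r , q , c ← pick-<0 w l (subst (ℤ._< 0ℤ) (sym f) ℤ.-<+)
  = y , r , q , unit-<0 (w y) (All.head (Perm.All-resp-↭ q bd)) c
pick-opposite w l bd -[1+ n ] s≢0 e | f
  with y , r , q , c ← pick-<0 (λ x → ℤ.- w x) l (subst (ℤ._< 0ℤ) (sym (trans (∑-neg w l) (cong ℤ.-_ f))) ℤ.-<+)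
  = y , r , q , unit->0 (w y) (All.head (Perm.All-resp-↭ q bd)) c

-- `n` bounds the number of vectors still to be chosen and `(a , b)` is the sum of those already
-- chosen. Zero is tested only after a choice, so the empty selection does not count.
hasZeroSum : ℕ → ℤ → ℤ → List (ℤ × ℤ) → Bool
hasZeroSum zero    a b _             = false
hasZeroSum (suc n) a b []            = false
hasZeroSum (suc n) a b ((x , y) ∷ P) =
  (⌊ a ℤ.+ x ℤ.≟ 0ℤ ⌋ ∧ ⌊ b ℤ.+ y ℤ.≟ 0ℤ ⌋) ∨
  (hasZeroSum n (a ℤ.+ x) (b ℤ.+ y) P ∨ hasZeroSum (suc n) a b P)

forUnits : (ℤ → Bool) → Bool
forUnits g = g -1ℤ ∧ (g 0ℤ ∧ g 1ℤ)

-- decomposable-suc would only give D(2) = 8, while 2 m_4 = 48 forces D(2) = 4;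
-- that bound comes from an exhaustive search.  search f P tests whether every way of
-- extending the selection P by at most f vectors, each opposing the current sum in its
-- first nonzero coordinate, meets a nonempty zero-sum part of at most four vectors.
search  : ℕ → List (ℤ × ℤ) → Bool
oppose  : ℕ → List (ℤ × ℤ) → ℤ → ℤ → Bool

search f P = hasZeroSum 4 0ℤ 0ℤ P ∨ oppose f P (∑ proj₁ P) (∑ proj₂ P)

oppose zero    P a b = false
oppose (suc f) P (+ zero) (+ zero) = false
oppose (suc f) P (+ zero) b = forUnits λ x → search f ((x , opposite b) ∷ P)
oppose (suc f) P a b = forUnits λ y → search f ((opposite a , y) ∷ P)

-- The search is run by the type checker: from each of the nine starting vectors, selections of at
-- most seven vectors suffice.
search-succeeds : forUnits (λ x → forUnits λ y → search 6 [ (x , y) ]) ≡ true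
search-succeeds = refl

private
  ∧-split : ∀ {a b} → a ∧ b ≡ true → a ≡ true × b ≡ true
  ∧-split {true} {true} refl = refl , refl

  ∨-split : ∀ {a b} → a ∨ b ≡ true → a ≡ true ⊎ b ≡ true
  ∨-split {true}  e = inj₁ refl
  ∨-split {false} e = inj₂ e

  ⌊⌋-sound : ∀ {P : Set} (d : Dec P) → ⌊ d ⌋ ≡ true → P
  ⌊⌋-sound (yes p) _ = p

forUnits-sound : ∀ g → forUnits g ≡ true → ∀ x → ∣ x ∣ ≤ 1 → g x ≡ true
forUnits-sound g e (+ zero)        _ = proj₁ (∧-split (proj₂ (∧-split {g -1ℤ} e)))
forUnits-sound g e (+ suc zero)    _ = proj₂ (∧-split {g 0ℤ} (proj₂ (∧-split {g -1ℤ} e)))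
forUnits-sound g e -[1+ zero ]     _ = proj₁ (∧-split e)
forUnits-sound g e (+ suc (suc _)) (s≤s ())
forUnits-sound g e -[1+ suc _ ]    (s≤s ())

module _ (u v : A → ℤ) where

  private
    vec : A → ℤ × ℤ
    vec x = u x , v x

    Bounded : List A → Set
    Bounded l = All (λ x → ∣ u x ∣ ≤ 1) l × All (λ x → ∣ v x ∣ ≤ 1) l

  -- The offset `(a , b)` is the sum of vectors chosen earlier, as in `hasZeroSum`. That `c` is
  -- nonempty lets the recursion in `decomposable-two` terminate.
  ZeroSumPart : ℕ → ℤ → ℤ → List A → Set
  ZeroSumPart n a b l = ∃₂ λ c r → c ++ r ↭ l × 1 ≤ length c × length c ≤ n ×
                        a ℤ.+ ∑ u c ≡ 0ℤ × b ℤ.+ ∑ v c ≡ 0ℤ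

  hasZeroSum-sound : ∀ n a b P → hasZeroSum n a b (map vec P) ≡ true → ZeroSumPart n a b P
  hasZeroSum-sound (suc n) a b (x ∷ P) e with ∨-split {⌊ a ℤ.+ u x ℤ.≟ 0ℤ ⌋ ∧ ⌊ b ℤ.+ v x ℤ.≟ 0ℤ ⌋} e
  ... | inj₁ now =
    let p , q = ∧-split now in
    x ∷ [] , P , ↭-refl , s≤s z≤n , s≤s z≤n ,
    trans (cong (λ z → a ℤ.+ z) (ℤ.+-identityʳ (u x))) (⌊⌋-sound (a ℤ.+ u x ℤ.≟ 0ℤ) p) ,
    trans (cong (λ z → b ℤ.+ z) (ℤ.+-identityʳ (v x))) (⌊⌋-sound (b ℤ.+ v x ℤ.≟ 0ℤ) q)
  ... | inj₂ later with ∨-split {hasZeroSum n (a ℤ.+ u x) (b ℤ.+ v x) (map vec P)} later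
  ... | inj₁ with-x =
    let c , r , q , _ , len , p₁ , p₂ = hasZeroSum-sound n (a ℤ.+ u x) (b ℤ.+ v x) P with-x in
    x ∷ c , r , prep x q , s≤s z≤n , s≤s len ,
    trans (sym (ℤ.+-assoc a (u x) _)) p₁ , trans (sym (ℤ.+-assoc b (v x) _)) p₂
  ... | inj₂ without-x =
    let c , r , q , pos , len , p₁ , p₂ = hasZeroSum-sound (suc n) a b P without-x in
    c , x ∷ r , ↭-trans (Perm.shift x c r) (prep x q) , pos , len , p₁ , p₂

  private
    shift-sum : ∀ (w : A → ℤ) {l r y} s → l ↭ y ∷ r → s ℤ.+ ∑ w l ≡ 0ℤ → (w y ℤ.+ s) ℤ.+ ∑ w r ≡ 0ℤ
    shift-sum w {r = r} {y} s q e = trans (rearrange (w y) s (∑ w r)) (trans (cong (λ z → s ℤ.+ z) (sym (∑-↭ w q))) e)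
      where
      rearrange : ∀ a b c → (a ℤ.+ b) ℤ.+ c ≡ b ℤ.+ (a ℤ.+ c)
      rearrange = solve-∀

  -- Invariant of the five mutual lemmas: `P` is the selection, `l` holds the remaining vectors, and
  -- both together sum to zero. Hence a nonzero sum of `P` is opposed by some vector of `l`, and one
  -- of the branches searched does occur.
  search-sound : ∀ f P l → search f (map vec P) ≡ true → Bounded l →
                 ∑ proj₁ (map vec P) ℤ.+ ∑ u l ≡ 0ℤ → ∑ proj₂ (map vec P) ℤ.+ ∑ v l ≡ 0ℤ →
                 ZeroSumPart 4 0ℤ 0ℤ (P ++ l)
  oppose-sound : ∀ f P l a b → oppose f (map vec P) a b ≡ true → Bounded l →
                 ∑ proj₁ (map vec P) ≡ a → ∑ proj₂ (map vec P) ≡ b →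
                 ∑ proj₁ (map vec P) ℤ.+ ∑ u l ≡ 0ℤ → ∑ proj₂ (map vec P) ℤ.+ ∑ v l ≡ 0ℤ →
                 ZeroSumPart 4 0ℤ 0ℤ (P ++ l)
  extend-sound : ∀ f P l {y r} → l ↭ y ∷ r → Bounded l → search f (vec y ∷ map vec P) ≡ true →
                 ∑ proj₁ (map vec P) ℤ.+ ∑ u l ≡ 0ℤ → ∑ proj₂ (map vec P) ℤ.+ ∑ v l ≡ 0ℤ →
                 ZeroSumPart 4 0ℤ 0ℤ (P ++ l)
  oppose-u     : ∀ f P l a → a ≢ 0ℤ → forUnits (λ y → search f ((opposite a , y) ∷ map vec P)) ≡ true →
                 Bounded l → ∑ proj₁ (map vec P) ≡ a →
                 ∑ proj₁ (map vec P) ℤ.+ ∑ u l ≡ 0ℤ → ∑ proj₂ (map vec P) ℤ.+ ∑ v l ≡ 0ℤ →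
                 ZeroSumPart 4 0ℤ 0ℤ (P ++ l)
  oppose-v     : ∀ f P l b → b ≢ 0ℤ → forUnits (λ x → search f ((x , opposite b) ∷ map vec P)) ≡ true →
                 Bounded l → ∑ proj₂ (map vec P) ≡ b →
                 ∑ proj₁ (map vec P) ℤ.+ ∑ u l ≡ 0ℤ → ∑ proj₂ (map vec P) ℤ.+ ∑ v l ≡ 0ℤ →
                 ZeroSumPart 4 0ℤ 0ℤ (P ++ l)

  search-sound f P l e bd eu ev with ∨-split {hasZeroSum 4 0ℤ 0ℤ (map vec P)} e
  ... | inj₁ now =
    let c , r , q , rest = hasZeroSum-sound 4 0ℤ 0ℤ P now in
    c , r ++ l , ↭-trans (↭-reflexive (sym (List.++-assoc c r l))) (Perm.++⁺ʳ l q) , rest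
  ... | inj₂ later = oppose-sound f P l _ _ later bd refl refl eu ev

  extend-sound f P l {y} {r} q (bu , bv) e eu ev =
    let bd′ = All.tail (Perm.All-resp-↭ q bu) , All.tail (Perm.All-resp-↭ q bv)
        c , r′ , q′ , rest = search-sound f (y ∷ P) r e bd′ (shift-sum u _ q eu) (shift-sum v _ q ev)
    in c , r′ , ↭-trans q′ (↭-trans (↭-sym (Perm.shift y P r)) (Perm.++⁺ˡ P (↭-sym q))) , rest

  oppose-u f P l a a≢0 e bd ea eu ev
    with y , r , q , c ← pick-opposite u l (proj₁ bd) a a≢0 (trans (cong (ℤ._+ ∑ u l) (sym ea)) eu)
    -- The first coordinate of `y` is forced by the sign of `a`; the second is free, and `forUnits`
    -- covers its three values.
    = extend-sound f P l q bd
        (subst (λ z → search f ((z , v y) ∷ map vec P) ≡ true) (sym c)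
          (forUnits-sound (λ z → search f ((opposite a , z) ∷ map vec P)) e (v y) (All.head (Perm.All-resp-↭ q (proj₂ bd)))))
        eu ev

  oppose-v f P l b b≢0 e bd eb eu ev
    with y , r , q , c ← pick-opposite v l (proj₂ bd) b b≢0 (trans (cong (ℤ._+ ∑ v l) (sym eb)) ev)
    = extend-sound f P l q bd
        (subst (λ z → search f ((u y , z) ∷ map vec P) ≡ true) (sym c)
          (forUnits-sound (λ z → search f ((z , opposite b) ∷ map vec P)) e (u y) (All.head (Perm.All-resp-↭ q (proj₁ bd)))))
        eu ev

  -- The missing cases, `f` zero or sum `(0 , 0)`, are absurd: there `oppose` is `false`.
  oppose-sound (suc f) P l (+ zero)  (+ suc n) e bd ea eb = oppose-v f P l _ (λ ()) e bd eb
  oppose-sound (suc f) P l (+ zero)  -[1+ n ]  e bd ea eb = oppose-v f P l _ (λ ()) e bd eb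
  oppose-sound (suc f) P l (+ suc m) b         e bd ea eb = oppose-u f P l _ (λ ()) e bd ea
  oppose-sound (suc f) P l -[1+ m ]  b         e bd ea eb = oppose-u f P l _ (λ ()) e bd ea

  zero-sum-part : ∀ x l → Bounded (x ∷ l) → ∑ u (x ∷ l) ≡ 0ℤ → ∑ v (x ∷ l) ≡ 0ℤ →
                  ZeroSumPart 4 0ℤ 0ℤ (x ∷ l)
  zero-sum-part x l (bu ∷ bus , bv ∷ bvs) eu ev =
    search-sound 6 (x ∷ []) l
      (forUnits-sound (λ z → search 6 ((u x , z) ∷ []))
        (forUnits-sound (λ z → forUnits λ z′ → search 6 ((z , z′) ∷ [])) search-succeeds (u x) bu) (v x) bv)
      (bus , bvs)
      (trans (cong (ℤ._+ ∑ u l) (ℤ.+-identityʳ (u x))) eu)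
      (trans (cong (ℤ._+ ∑ v l) (ℤ.+-identityʳ (v x))) ev)

-- Zero-sum parts of at most four vectors are removed one by one; what remains has sum zero again.
decomposable-two : Decomposable 2 4
decomposable-two w l = go (length l) l ℕ.≤-refl
  where
  go : ∀ n l → length l ≤ n → (∀ a → All (λ x → ∣ w a x ∣ ≤ 1) l) → (∀ a → ∑ (w a) l ≡ 0ℤ) →
       ∃ λ bs → concat bs ↭ l × All (λ b → length b ≤ 4 × (∀ a → ∑ (w a) b ≡ 0ℤ)) bs
  go n []      _   bd e = [] , ↭-refl , []
  go (suc n) (x ∷ l) len bd e
    with zero-sum-part (w zero) (w (suc zero)) x l (bd zero , bd (suc zero)) (e zero) (e (suc zero))
  ... | c@(_ ∷ c′) , r , q , _ , len-c , z₀ , z₁ =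
    let bs , q′ , ok = go n r shorter (λ a → All.++⁻ʳ c (Perm.All-resp-↭ (↭-sym q) (bd a)))
                         (λ a → ∑-rest (w a) {c} q (zc a) (e a))
    in c ∷ bs , ↭-trans (Perm.++⁺ˡ c q′) q , (len-c , zc) ∷ ok
    where
    zc : ∀ a → ∑ (w a) c ≡ 0ℤ
    zc zero       = trans (sym (ℤ.+-identityˡ _)) z₀
    zc (suc zero) = trans (sym (ℤ.+-identityˡ _)) z₁
    shorter : length r ≤ n
    shorter = ℕ.≤-trans (subst (length r ≤_) (sym (List.length-++ c′)) (ℕ.m≤n+m (length r) (length c′)))
      (ℕ.≤-pred (subst (_≤ suc n) (sym (Perm.↭-length q)) len))

-- Zero-sum subfamilies of prescribed size

filter-∁-↭ : {P : Pred A 0ℓ} (P? : Decidable P) (l : List A) → filter P? l ++ filter (∁? P?) l ↭ l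
filter-∁-↭ P? []      = ↭-refl
filter-∁-↭ P? (x ∷ l) with P? x
... | yes _ = prep x (filter-∁-↭ P? l)
... | no _  = ↭-trans (Perm.shift x (filter P? l) _) (prep x (filter-∁-↭ P? l))

length-concat-≡ : ∀ {d} {bs : List (List A)} → All (λ b → length b ≡ d) bs →
                  length (concat bs) ≡ length bs * d
length-concat-≡ [] = refl
length-concat-≡ {bs = b ∷ bs} (p ∷ ps) = trans (List.length-++ b) (cong₂ ℕ._+_ p (length-concat-≡ ps))

-- Pigeonhole on block lengths: some length i ≤ d occurs at least (1 + g) / i times.
blocks-of-total-length : ∀ {g} d (bs : List (List A)) → (∀ i → i < d → suc i ∣ suc g) →
                         All (λ b → length b ≤ d) bs → d * g < length (concat bs) →
                         ∃₂ λ cs ds → cs ++ ds ↭ bs × length (concat cs) ≡ suc g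
blocks-of-total-length zero bs _ short large =
  contradiction (ℕ.≤-trans large (length-concat-≤ short))
    (ℕ.<⇒≱ (subst (_< 1) (sym (ℕ.*-zeroʳ (length bs))) (s≤s z≤n)))
blocks-of-total-length {A = A} {g} (suc d) bs dvd short large with dvd d ℕ.≤-refl
... | divides q G≡ = body
  where
  full? : Decidable {A = List A} (λ b → length b ≡ suc d)
  full? b = length b ℕ.≟ suc d
  fs rs : List (List A)
  fs = filter full? bs
  rs = filter (∁? full?) bs
  fs-full : All (λ b → length b ≡ suc d) fs
  fs-full = All.all-filter full? bs
  split : fs ++ rs ↭ bs
  split = filter-∁-↭ full? bs
  rs-short : All (λ b → length b ≤ d) rs
  rs-short = All.zipWith (λ (p , q) → ℕ.≤-pred (ℕ.≤∧≢⇒< p q))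
    (All.++⁻ʳ fs (Perm.All-resp-↭ (↭-sym split) short) , All.all-filter (∁? full?) bs)
  body : ∃₂ λ cs ds → cs ++ ds ↭ bs × length (concat cs) ≡ suc g
  body with q ℕ.≤? length fs
  ... | yes q≤ = take q fs , drop q fs ++ rs ,
    ↭-trans (↭-reflexive (trans (sym (List.++-assoc (take q fs) _ rs)) (cong (_++ rs) (List.take++drop≡id q fs)))) split ,
    trans (length-concat-≡ (All.take⁺ q fs-full))
      (trans (cong (_* suc d) (trans (List.length-take q fs) (ℕ.m≤n⇒m⊓n≡m q≤))) (sym G≡))
  ... | no q≰ =
    let cs , ds , perm , total = blocks-of-total-length d rs (λ i i<d → dvd i (ℕ.m≤n⇒m≤1+n i<d)) rs-short rs-large
    in cs , fs ++ ds , ↭-trans (Perm.shifts cs fs) (↭-trans (Perm.++⁺ˡ fs perm) split) , total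
    where
    -- Fewer than `q` full blocks have total length below `q * suc d = suc g`; without them the
    -- shorter blocks still exceed `d * g`.
    fs-small : length (concat fs) ≤ g
    fs-small = ℕ.≤-pred (subst (length (concat fs) <_) (sym G≡)
      (subst (_< q * suc d) (sym (length-concat-≡ fs-full)) (ℕ.*-monoˡ-< (suc d) (ℕ.≰⇒> q≰))))
    rs-large : d * g < length (concat rs)
    rs-large = ℕ.+-cancelˡ-< g _ _ (ℕ.<-≤-trans large
      (subst (_≤ g ℕ.+ length (concat rs))
        (trans (sym (List.length-++ (concat fs)))
          (trans (cong length (List.concat-++ fs rs)) (Perm.↭-length (concat-↭ split))))
        (ℕ.+-monoˡ-≤ (length (concat rs)) fs-small)))

ZeroSumSplit : ∀ {k} → (Fin k → A → ℤ) → ℕ → List A → Set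
ZeroSumSplit w m l = ∃₂ λ c r → c ++ r ↭ l × length c ≡ m × (∀ a → ∑ (w a) c ≡ 0ℤ)

module _ {k D g : ℕ} (dec : Decomposable k D) (dvd : ∀ i → i < D → suc i ∣ suc g) where

  -- `suc g` is a common multiple of `1, ..., D`, later `Γ D`. Concatenating whole blocks keeps
  -- every coordinate sum zero.
  zero-sum-of-length : (w : Fin k → A → ℤ) (l : List A) →
    (∀ a → All (λ x → ∣ w a x ∣ ≤ 1) l) → (∀ a → ∑ (w a) l ≡ 0ℤ) →
    D * g < length l → ZeroSumSplit w (suc g) l
  zero-sum-of-length w l bd e large
    with bs , q , ok ← dec w l bd e
    with cs , ds , q′ , total ← blocks-of-total-length D bs dvd (All.map proj₁ ok)
                                  (subst (D * g <_) (sym (Perm.↭-length q)) large)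
    = concat cs , concat ds , ↭-trans (↭-reflexive (List.concat-++ cs ds)) (↭-trans (concat-↭ q′) q) , total ,
      λ a → trans (∑-concat (w a) cs)
        (∑-zero _ (All.map (λ z → proj₂ z a) (All.++⁻ˡ cs (Perm.All-resp-↭ (↭-sym q′) ok))))

  -- Subfamilies of size `suc g` are removed `q` times. The reserve `p` ensures that before each
  -- removal at least `(1 + p) * suc g` vectors are present, which exceeds `D * g` because
  -- `D ≤ 1 + p`.
  zero-sum-of-multiple : ∀ q {p} → D ≤ suc p → (w : Fin k → A → ℤ) (l : List A) →
    (∀ a → All (λ x → ∣ w a x ∣ ≤ 1) l) → (∀ a → ∑ (w a) l ≡ 0ℤ) →
    length l ≡ (q ℕ.+ p) * suc g → ZeroSumSplit w (q * suc g) l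
  zero-sum-of-multiple zero    D≤ w l bd e len = [] , l , ↭-refl , refl , λ _ → refl
  zero-sum-of-multiple (suc q) {p} D≤ w l bd e len =
    let c , r , perm , len-c , z = zero-sum-of-length w l bd e large
        len-r = ℕ.+-cancelˡ-≡ (suc g) _ _ (trans (cong (ℕ._+ length r) (sym len-c))
                  (trans (sym (List.length-++ c)) (trans (Perm.↭-length perm) len)))
        c′ , r′ , perm′ , len-c′ , z′ = zero-sum-of-multiple q D≤ w r
          (λ a → All.++⁻ʳ c (Perm.All-resp-↭ (↭-sym perm) (bd a))) (λ a → ∑-rest (w a) {c} perm (z a) (e a)) len-r
    in c ++ c′ , r′ , ↭-trans (↭-reflexive (List.++-assoc c c′ r′)) (↭-trans (Perm.++⁺ˡ c perm′) perm) ,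
       trans (List.length-++ c) (cong₂ ℕ._+_ len-c len-c′) ,
       λ a → trans (∑-++ (w a) c c′) (cong₂ ℤ._+_ (z a) (z′ a))
    where
    large : D * g < length l
    large = subst (D * g <_) (sym len) (ℕ.≤-<-trans (ℕ.*-monoˡ-≤ g (ℕ.≤-trans D≤ (s≤s (ℕ.m≤n+m p q))))
              (ℕ.*-monoʳ-< (suc (q ℕ.+ p)) ℕ.≤-refl))

-- Divisibility by `Γ` and growth of the sequence `mseq`

∣Γ : ∀ {i} m → i < m → suc i ∣ Γ m
∣Γ {i} (suc m) i<1+m with ℕ.m≤n⇒m<n∨m≡n (ℕ.≤-pred i<1+m)
... | inj₁ i<m  = ∣-trans (∣Γ m i<m) (n∣lcm[m,n] (suc m) (Γ m))
... | inj₂ refl = m∣lcm[m,n] (suc m) (Γ m)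

Γ-least : ∀ m {c} → (∀ i → i < m → suc i ∣ c) → Γ m ∣ c
Γ-least zero    {c} h = 1∣ c
Γ-least (suc m) h = lcm-least (h m ℕ.≤-refl) (Γ-least m (λ i i<m → h i (ℕ.m≤n⇒m≤1+n i<m)))

Γ>0 : ∀ m → 0 < Γ m
Γ>0 zero    = s≤s z≤n
Γ>0 (suc m) = ℕ.n≢0⇒n>0 λ lcm≡0 → contradiction
  (trans (sym (gcd*lcm (suc m) (Γ m))) (trans (cong (gcd (suc m) (Γ m) *_) lcm≡0) (ℕ.*-zeroʳ (gcd (suc m) (Γ m)))))
  (ℕ.m<n⇒n≢0 (ℕ.*-mono-≤ {1} {suc m} (s≤s z≤n) (Γ>0 m)))

Γ-mono-∣ : ∀ {m n} → m ≤ n → Γ m ∣ Γ n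
Γ-mono-∣ {m} {n} m≤n = Γ-least m (λ i i<m → ∣Γ n (ℕ.<-≤-trans i<m m≤n))

-- The bound `D(2 + j)`.
blockBound : ℕ → ℕ
blockBound zero    = 4
blockBound (suc j) = (blockBound j ℕ.+ blockBound j) * blockBound j

blockBound>0 : ∀ j → 1 ≤ blockBound j
blockBound>0 zero    = s≤s z≤n
blockBound>0 (suc j) = ℕ.*-mono-≤ (ℕ.≤-trans (blockBound>0 j) (ℕ.m≤m+n _ _)) (blockBound>0 j)

decomposable : ∀ j → Decomposable (2 ℕ.+ j) (blockBound j)
decomposable zero    = decomposable-two
decomposable (suc j) = decomposable-suc (blockBound>0 j) (decomposable j)

private
  step : ℕ → ℕ
  step a = 2 * a * (a ∸ 1) * Γ (2 * a ∸ 1)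

-- `Γ (2a - 1)` is at least 2, being divisible by 2, and `2(a - 1) ≥ a`. So `mseq` grows at least as
-- fast as the recursion `D(k+1) = 2 D(k)²`.
step-grows : ∀ a → 2 ≤ a → (a ℕ.+ a) * a ≤ step a
step-grows (suc zero) (s≤s ())
step-grows a@(suc (suc b)) 2≤a = subst (_≤ step a) (cong (_* a) (cong (a ℕ.+_) (ℕ.+-identityʳ a)))
  (subst (2 * a * a ≤_) (sym (ℕ.*-assoc (2 * a) (suc b) G)) (ℕ.*-monoʳ-≤ (2 * a) a≤))
  where
  G : ℕ
  G = Γ (2 * a ∸ 1)
  2≤G : 2 ≤ G
  2≤G = ∣⇒≤ {{ℕ.>-nonZero (Γ>0 (2 * a ∸ 1))}}
    (∣Γ {1} (2 * a ∸ 1) (s≤s (ℕ.≤-trans (s≤s z≤n) (ℕ.m≤n+m (suc (suc (b ℕ.+ 0))) b))))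
  a≤ : a ≤ suc b * G
  a≤ = ℕ.≤-trans (subst (a ≤_) (ℕ.*-comm 2 (suc b)) (s≤s (ℕ.≤-trans (ℕ.m≤n+m (suc b) b) (ℕ.+-monoʳ-≤ b (ℕ.m≤m+n _ _)))))
         (ℕ.*-monoʳ-≤ (suc b) 2≤G)

mseq≥2 : ∀ i → 2 ≤ mseq (3 ℕ.+ i)
mseq-grows : ∀ i → (mseq (3 ℕ.+ i) ℕ.+ mseq (3 ℕ.+ i)) * mseq (3 ℕ.+ i) ≤ mseq (4 ℕ.+ i)

mseq≥2 zero    = ℕ.≤-refl
mseq≥2 (suc i) = ℕ.≤-trans
  (ℕ.*-mono-≤ {2} {_} {1} (ℕ.≤-trans (mseq≥2 i) (ℕ.m≤m+n _ _)) (ℕ.≤-trans (s≤s z≤n) (mseq≥2 i)))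
  (mseq-grows i)

mseq-grows i = step-grows (mseq (3 ℕ.+ i)) (mseq≥2 i)

mseq-mono : ∀ i → mseq (3 ℕ.+ i) ≤ mseq (4 ℕ.+ i)
mseq-mono i = ℕ.≤-trans (ℕ.m≤m*n a a {{ℕ.>-nonZero a>0}}) (ℕ.≤-trans (ℕ.*-monoˡ-≤ a (ℕ.m≤m+n a a)) (mseq-grows i))
  where
  a : ℕ
  a = mseq (3 ℕ.+ i)
  a>0 : 0 < a
  a>0 = ℕ.≤-trans (s≤s z≤n) (mseq≥2 i)

-- One growth step of `mseq` pays for one step of `blockBound`, while the index advances by two. The
-- odd version says `D(k) ≤ m_{2k-1}` for `k ≥ 3` and leaves the last step of `mseq` to
-- `hasQuotient-step`.
blockBound≤mseq : ∀ j → blockBound j ≤ mseq (4 ℕ.+ j * 2)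
blockBound≤mseq-odd : ∀ j → blockBound (suc j) ≤ mseq (5 ℕ.+ j * 2)

-- `mseq 4 = 24`.
blockBound≤mseq zero    = ℕ.m≤m+n 4 20
blockBound≤mseq (suc j) = ℕ.≤-trans (blockBound≤mseq-odd j) (mseq-mono (2 ℕ.+ j * 2))

blockBound≤mseq-odd j = ℕ.≤-trans (ℕ.*-mono-≤ (ℕ.+-mono-≤ h h) h) (mseq-grows (1 ℕ.+ j * 2))
  where
  h : blockBound j ≤ mseq (4 ℕ.+ j * 2)
  h = blockBound≤mseq j

-- The bound `q ≥ D - 1` is what the reserve in `zero-sum-of-multiple` has to satisfy.
HasQuotient : ℕ → ℕ → Set
HasQuotient D m = ∃ λ q → m ≡ q * Γ D × D ≤ suc q

-- Since `D ≤ a ≤ 2a - 1`, `Γ D` divides the factor `Γ (2a - 1)` of `step a`; the other factor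
-- `2a(a - 1)` already makes the quotient large enough.
hasQuotient-step : ∀ D a → 2 ≤ a → D ≤ a → HasQuotient D (2 * step a)
hasQuotient-step D (suc zero) (s≤s ())
hasQuotient-step D a@(suc (suc b)) 2≤a D≤a
  with Γ-mono-∣ (ℕ.≤-trans D≤a (ℕ.≤-trans (ℕ.m≤m+n a 0) (ℕ.m≤n+m (a ℕ.+ 0) (suc b))))
... | divides zero    Γ≡0 = contradiction Γ≡0 (ℕ.m<n⇒n≢0 (Γ>0 (2 * a ∸ 1)))
... | divides (suc t) Γ≡  = 2 * (X * suc t) ,
  trans (cong (λ z → 2 * (X * z)) Γ≡)
    (trans (cong (2 *_) (sym (ℕ.*-assoc X (suc t) (Γ D)))) (sym (ℕ.*-assoc 2 (X * suc t) (Γ D)))) ,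
  ℕ.m≤n⇒m≤1+n (ℕ.≤-trans D≤a (ℕ.≤-trans (ℕ.m≤m+n a _) (ℕ.≤-trans (ℕ.m≤m*n (2 * a) (suc b))
    (ℕ.≤-trans (ℕ.m≤m*n X (suc t)) (ℕ.m≤m+n (X * suc t) _)))))
  where
  X : ℕ
  X = 2 * a * suc b

-- The small cases are `2 m_2 = 2 = 1 * Γ 2`, where the quotient is exactly `D - 1`, and
-- `2 m_4 = 48 = 4 * Γ 4`.
decomposable-mseq : ∀ k → 1 ≤ k → ∃ λ D → Decomposable k D × HasQuotient D (2 * mseq (2 * k))
decomposable-mseq (suc zero)          _ = 2 , decomposable-suc (s≤s z≤n) decomposable-zero , 1 , refl , ℕ.≤-refl
decomposable-mseq (suc (suc zero))    _ = 4 , decomposable-two , 4 , refl , ℕ.m≤m+n 4 1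
decomposable-mseq (suc (suc (suc j))) _ = blockBound (suc j) , decomposable (suc j) ,
  subst (λ i → HasQuotient (blockBound (suc j)) (2 * mseq i)) (ℕ.*-comm (3 ℕ.+ j) 2)
    (hasQuotient-step _ (mseq (5 ℕ.+ j * 2)) (mseq≥2 (2 ℕ.+ j * 2)) (blockBound≤mseq-odd j))

-- Both `q` and `p` of `zero-sum-of-multiple` are taken to be `l` divided by `Γ D`: the half that is
-- not collected serves as the reserve.
zero-sum-half : ∀ {k l} → 1 ≤ k → 0 < l → 2 * mseq (2 * k) ∣ l →
  (w : Fin k → A → ℤ) (xs : List A) → (∀ a → All (λ x → ∣ w a x ∣ ≤ 1) xs) → (∀ a → ∑ (w a) xs ≡ 0ℤ) →
  length xs ≡ l ℕ.+ l → ZeroSumSplit w l xs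
zero-sum-half {k = k} 1≤k () (divides zero refl) w xs bd e len
zero-sum-half {k = k} 1≤k _ (divides (suc s) refl) w xs bd e len
  with D , dec , q , m≡ , D≤ ← decomposable-mseq k 1≤k
  = subst (λ m → ZeroSumSplit w m xs) (sym l≡)
      (zero-sum-of-multiple {g = ℕ.pred (Γ D)} dec (λ i i<D → subst (suc i ∣_) (sym Γ≡) (∣Γ D i<D)) (suc s * q)
        (ℕ.≤-trans D≤ (s≤s (ℕ.m≤m+n q (s * q)))) w xs bd e
        (trans len (trans (cong₂ ℕ._+_ l≡ l≡) (sym (ℕ.*-distribʳ-+ (suc (ℕ.pred (Γ D))) (suc s * q) (suc s * q))))))
  where
  Γ≡ : suc (ℕ.pred (Γ D)) ≡ Γ D
  Γ≡ = ℕ.suc-pred (Γ D) {{ℕ.>-nonZero (Γ>0 D)}}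
  l≡ : suc s * (2 * mseq (2 * k)) ≡ suc s * q * suc (ℕ.pred (Γ D))
  l≡ = trans (cong (suc s *_) (trans m≡ (cong (q *_) (sym Γ≡)))) (sym (ℕ.*-assoc (suc s) q _))

-- Counting identities

indicator : Bool → ℤ
indicator true  = 1ℤ
indicator false = 0ℤ

count-∑ : (p : A → Bool) (g : Fin n → A) → ∑ (indicator ∘ p) (tabulate g) ≡ + count (p ∘ g)
count-∑ {n = zero}  p g = refl
count-∑ {n = suc n} p g with p (g zero)
... | true  = cong (λ z → 1ℤ ℤ.+ z) (count-∑ p (g ∘ suc))
... | false = trans (ℤ.+-identityˡ _) (count-∑ p (g ∘ suc))

count-cong : {p q : Fin n → Bool} → p ≗ q → count p ≡ count q
count-cong {zero}  h = refl
count-cong {suc n} {p} {q} h with p zero | q zero | h zero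
... | true  | .true  | refl = cong suc (count-cong (h ∘ suc))
... | false | .false | refl = count-cong (h ∘ suc)

count-∧-not : (p q : Fin n → Bool) → count (λ i → p i ∧ q i) ℕ.+ count (λ i → not (p i) ∧ q i) ≡ count q
count-∧-not {zero}  p q = refl
count-∧-not {suc n} p q with p zero | q zero
... | true  | true  = cong suc (count-∧-not (p ∘ suc) (q ∘ suc))
... | true  | false = count-∧-not (p ∘ suc) (q ∘ suc)
... | false | true  = trans (ℕ.+-suc _ _) (cong suc (count-∧-not (p ∘ suc) (q ∘ suc)))
... | false | false = count-∧-not (p ∘ suc) (q ∘ suc)

count-∧-not′ : (p q : Fin n → Bool) → count (λ i → p i ∧ q i) ℕ.+ count (λ i → p i ∧ not (q i)) ≡ count p
count-∧-not′ {zero}  p q = refl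
count-∧-not′ {suc n} p q with p zero | q zero
... | true  | true  = cong suc (count-∧-not′ (p ∘ suc) (q ∘ suc))
... | true  | false = trans (ℕ.+-suc _ _) (cong suc (count-∧-not′ (p ∘ suc) (q ∘ suc)))
... | false | true  = count-∧-not′ (p ∘ suc) (q ∘ suc)
... | false | false = count-∧-not′ (p ∘ suc) (q ∘ suc)

count-not : (p : Fin n → Bool) → count p ℕ.+ count (not ∘ p) ≡ n
count-not {zero}  p = refl
count-not {suc n} p with p zero
... | true  = cong suc (count-not (p ∘ suc))
... | false = trans (ℕ.+-suc _ _) (cong suc (count-not (p ∘ suc)))

count-↑ : ∀ m {n} (p : Fin (m ℕ.+ n) → Bool) → count p ≡ count (λ c → p (c ↑ˡ n)) ℕ.+ count (λ c → p (m ↑ʳ c))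
count-↑ zero    p = refl
count-↑ (suc m) p with p zero
... | true  = cong suc (count-↑ m (p ∘ suc))
... | false = count-↑ m (p ∘ suc)

count2-↑ : ∀ m {n r} (p : Fin (m ℕ.+ n) → Fin r → Bool) →
           count2 p ≡ count2 (λ c → p (c ↑ˡ n)) ℕ.+ count2 (λ c → p (m ↑ʳ c))
count2-↑ zero    p = refl
count2-↑ (suc m) p = trans (cong (count (p zero) ℕ.+_) (count2-↑ m (p ∘ suc))) (sym (ℕ.+-assoc (count (p zero)) _ _))

count2-+ : ∀ {r l} (p q : Fin n → Fin r → Bool) → (∀ c → count (p c) ℕ.+ count (q c) ≡ l) →
           count2 p ℕ.+ count2 q ≡ n * l
count2-+ {zero}  p q h = refl
count2-+ {suc n} p q h = trans (interchange (count (p zero)) _ (count (q zero)) _)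
  (cong₂ ℕ._+_ (h zero) (count2-+ (p ∘ suc) (q ∘ suc) (h ∘ suc)))

private
  bit : Bool → ℕ
  bit true  = 1
  bit false = 0

  count-sum : (p : Fin n → Bool) → count p ≡ sum (bit ∘ p)
  count-sum {zero}  p = refl
  count-sum {suc n} p with p zero
  ... | true  = cong suc (count-sum (p ∘ suc))
  ... | false = count-sum (p ∘ suc)

  count2-sum : (p : Fin m → Fin n → Bool) → count2 p ≡ sum (λ i → sum (λ j → bit (p i j)))
  count2-sum {zero}  p = refl
  count2-sum {suc m} p = cong₂ ℕ._+_ (count-sum (p zero)) (count2-sum (p ∘ suc))

-- Needed because `count2` runs through rows, whereas the square is built from pairs of columns.
count2-transpose : (p : Fin m → Fin n → Bool) → count2 p ≡ count2 (λ j i → p i j)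
count2-transpose p = trans (count2-sum p) (trans (∑-comm (λ i j → bit (p i j))) (sym (count2-sum (λ j i → p i j))))

-- Selecting half of the rows for one pair of columns

∑-cong : {f g : A → ℤ} {l : List A} → All (λ x → f x ≡ g x) l → ∑ f l ≡ ∑ g l
∑-cong []       = refl
∑-cong (e ∷ es) = cong₂ ℤ._+_ e (∑-cong es)

∑-minus : (f g : A → ℤ) (l : List A) → ∑ (λ x → f x ℤ.- g x) l ≡ ∑ f l ℤ.- ∑ g l
∑-minus f g []      = refl
∑-minus f g (x ∷ l) = trans (cong (λ z → (f x ℤ.- g x) ℤ.+ z) (∑-minus f g l)) (rearrange (f x) (g x) (∑ f l) (∑ g l))
  where
  rearrange : ∀ a b c d → (a ℤ.- b) ℤ.+ (c ℤ.- d) ≡ (a ℤ.+ c) ℤ.- (b ℤ.+ d)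
  rearrange = solve-∀

∑-ones : (l : List A) → ∑ (λ _ → 1ℤ) l ≡ + length l
∑-ones []      = refl
∑-ones (x ∷ l) = cong (λ z → 1ℤ ℤ.+ z) (∑-ones l)

unique-++⇒∉ : (c r : List A) → Unique (c ++ r) → All (_∉ c) r
unique-++⇒∉ []      r u       = All.universal (λ _ ()) r
unique-++⇒∉ (x ∷ c) r (n ∷ u) = All.zipWith (λ (p , q) → λ { (here e) → p (sym e) ; (there i) → q i })
  (All.++⁻ʳ c n , unique-++⇒∉ c r u)

module _ {n : ℕ} where
  open DecMembership (Fin._≟_ {n}) using () renaming (_∈?_ to _∈Fin?_)

  member : List (Fin n) → Fin n → Bool
  member c i = ⌊ i ∈Fin? c ⌋

  private
    member-true : ∀ {i} c → i ∈ c → member c i ≡ true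
    member-true {i} c h with i ∈Fin? c
    ... | yes _ = refl
    ... | no ¬h = contradiction h ¬h

    member-false : ∀ {i} c → i ∉ c → member c i ≡ false
    member-false {i} c h with i ∈Fin? c
    ... | yes i∈ = contradiction i∈ h
    ... | no _   = refl

  -- `allFin n` has no repetitions, so no entry of `r` recurs in `c`, and only `c` contributes to
  -- the count.
  count-member : ∀ {c r : List (Fin n)} → c ++ r ↭ allFin n → (p : Fin n → Bool) →
                 + count (λ i → member c i ∧ p i) ≡ ∑ (indicator ∘ p) c
  count-member {c} {r} perm p =
    trans (sym (count-∑ q (λ i → i)))
      (trans (∑-↭ (indicator ∘ q) (↭-sym perm))
        (trans (∑-++ (indicator ∘ q) c r)
          (trans (cong₂ ℤ._+_ (∑-cong inside) (∑-zero (indicator ∘ q) outside)) (ℤ.+-identityʳ _))))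
    where
    q : Fin n → Bool
    q i = member c i ∧ p i
    inside : All (λ i → indicator (q i) ≡ indicator (p i)) c
    inside = All.tabulate λ {i} h → cong (λ b → indicator (b ∧ p i)) (member-true c h)
    outside : All (λ i → indicator (q i) ≡ 0ℤ) r
    outside = All.map (λ {i} h → cong (λ b → indicator (b ∧ p i)) (member-false c h))
      (unique-++⇒∉ c r (PermSetoid.Unique-resp-↭ (setoid (Fin n)) (↭⇒↭ₛ (↭-sym perm)) (allFin⁺ n)))

private
  ∣indicator-∣≤1 : ∀ a b → ∣ indicator a ℤ.- indicator b ∣ ≤ 1
  ∣indicator-∣≤1 true  true  = z≤n
  ∣indicator-∣≤1 true  false = s≤s z≤n
  ∣indicator-∣≤1 false true  = s≤s z≤n
  ∣indicator-∣≤1 false false = z≤n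

-- Equal counts make the differences of indicators sum to zero, and a zero-sum half of them is a
-- half of the rows on which the counts agree.
half-of-rows : ∀ {k l} → 1 ≤ k → 0 < l → 2 * mseq (2 * k) ∣ l →
  (p q : Fin k → Fin (l ℕ.+ l) → Bool) → (∀ a → count (p a) ≡ count (q a)) →
  ∃ λ R → count R ≡ l × (∀ a → count (λ i → R i ∧ p a i) ≡ count (λ i → R i ∧ q a i))
half-of-rows {k} {l} 1≤k 0<l dvd p q eq = member c , ℤ.+-injective count-c , λ a → ℤ.+-injective (balanced a)
  where
  w : Fin k → Fin (l ℕ.+ l) → ℤ
  w a i = indicator (p a i) ℤ.- indicator (q a i)
  ∑-w : ∀ a xs → ∑ (w a) xs ≡ ∑ (indicator ∘ p a) xs ℤ.- ∑ (indicator ∘ q a) xs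
  ∑-w a = ∑-minus (indicator ∘ p a) (indicator ∘ q a)
  split : ZeroSumSplit w l (allFin (l ℕ.+ l))
  split = zero-sum-half 1≤k 0<l dvd w (allFin (l ℕ.+ l))
    (λ a → All.universal (λ i → ∣indicator-∣≤1 (p a i) (q a i)) _)
    (λ a → trans (∑-w a (allFin (l ℕ.+ l))) (ℤ.i≡j⇒i-j≡0
      (trans (count-∑ (p a) (λ i → i)) (trans (cong +_ (eq a)) (sym (count-∑ (q a) (λ i → i)))))))
    (List.length-tabulate {n = l ℕ.+ l} (λ i → i))
  c : List (Fin (l ℕ.+ l))
  c = proj₁ split
  perm : c ++ proj₁ (proj₂ split) ↭ allFin (l ℕ.+ l)
  perm = proj₁ (proj₂ (proj₂ split))
  count-c : + count (member c) ≡ + l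
  count-c = trans (cong +_ (count-cong (λ i → sym (∧-identityʳ (member c i)))))
    (trans (count-member perm (λ _ → true)) (trans (∑-ones c) (cong +_ (proj₁ (proj₂ (proj₂ (proj₂ split)))))))
  balanced : ∀ a → + count (λ i → member c i ∧ p a i) ≡ + count (λ i → member c i ∧ q a i)
  balanced a = trans (count-member perm (p a))
    (trans (ℤ.i-j≡0⇒i≡j _ _ (trans (sym (∑-w a c)) (proj₂ (proj₂ (proj₂ (proj₂ split))) a))) (sym (count-member perm (q a))))

-- The square built from the selected rows and its orthogonality

symbol : Bool → Fin 2
symbol true  = zero
symbol false = suc zero

private
  is-zero : ∀ b → ⌊ symbol b Fin.≟ zero ⌋ ≡ b
  is-zero true  = refl
  is-zero false = refl

  is-one : ∀ b → ⌊ symbol b Fin.≟ suc zero ⌋ ≡ not b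
  is-one true  = refl
  is-one false = refl

  one-not-zero : (x : Fin 2) → ⌊ x Fin.≟ suc zero ⌋ ≡ not ⌊ x Fin.≟ zero ⌋
  one-not-zero zero       = refl
  one-not-zero (suc zero) = refl

↑-elim : ∀ m {n} {P : Fin (m ℕ.+ n) → Set} → (∀ c → P (c ↑ˡ n)) → (∀ c → P (m ↑ʳ c)) → ∀ j → P j
↑-elim m {n} {P} f g j = subst P (Fin.join-splitAt m n j) (by-side (splitAt m j))
  where
  by-side : ∀ s → P (Fin.join m n s)
  by-side (inj₁ c) = f c
  by-side (inj₂ c) = g c

module Mate {l : ℕ} (R : Fin l → Fin (l ℕ.+ l) → Bool) where

  mate : Square (l ℕ.+ l) 2
  mate i j = symbol ([ (λ c → R c i) , (λ c → not (R c i)) ]′ (splitAt l j))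

  mate-left : ∀ i c → mate i (c ↑ˡ l) ≡ symbol (R c i)
  mate-left i c rewrite Fin.splitAt-↑ˡ l c l = refl

  mate-right : ∀ i c → mate i (l ↑ʳ c) ≡ symbol (not (R c i))
  mate-right i c rewrite Fin.splitAt-↑ʳ l l c = refl

  left-zero : ∀ i c → ⌊ mate i (c ↑ˡ l) Fin.≟ zero ⌋ ≡ R c i
  left-zero i c = trans (cong (λ x → ⌊ x Fin.≟ zero ⌋) (mate-left i c)) (is-zero (R c i))

  left-one : ∀ i c → ⌊ mate i (c ↑ˡ l) Fin.≟ suc zero ⌋ ≡ not (R c i)
  left-one i c = trans (cong (λ x → ⌊ x Fin.≟ suc zero ⌋) (mate-left i c)) (is-one (R c i))

  right-zero : ∀ i c → ⌊ mate i (l ↑ʳ c) Fin.≟ zero ⌋ ≡ not (R c i)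
  right-zero i c = trans (cong (λ x → ⌊ x Fin.≟ zero ⌋) (mate-right i c)) (is-zero (not (R c i)))

  right-one : ∀ i c → ⌊ mate i (l ↑ʳ c) Fin.≟ suc zero ⌋ ≡ R c i
  right-one i c = trans (cong (λ x → ⌊ x Fin.≟ suc zero ⌋) (mate-right i c))
    (trans (is-one (not (R c i))) (not-involutive (R c i)))

  -- In every row the columns `c` and `c + l` carry different symbols, for any choice of `R`.
  mate-rows : ∀ s i → count (λ j → ⌊ mate i j Fin.≟ s ⌋) ≡ l
  mate-rows zero i = trans (count-↑ l _)
    (trans (cong₂ ℕ._+_ (count-cong (left-zero i)) (count-cong (right-zero i))) (count-not (λ c → R c i)))
  mate-rows (suc zero) i = trans (count-↑ l _)
    (trans (cong₂ ℕ._+_ (count-cong (left-one i)) (count-cong (right-one i)))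
      (trans (ℕ.+-comm (count (λ c → not (R c i))) _) (count-not (λ c → R c i))))

  module _ (count-R : ∀ c → count (R c) ≡ l) where

    private
      count-not-R : ∀ c → count (not ∘ R c) ≡ l
      count-not-R c = ℕ.+-cancelˡ-≡ l _ _ (trans (cong (ℕ._+ count (not ∘ R c)) (sym (count-R c))) (count-not (R c)))

    mate-columns : ∀ s j → count (λ i → ⌊ mate i j Fin.≟ s ⌋) ≡ l
    mate-columns zero = ↑-elim l
      (λ c → trans (count-cong (λ i → left-zero i c)) (count-R c))
      (λ c → trans (count-cong (λ i → right-zero i c)) (count-not-R c))
    mate-columns (suc zero) = ↑-elim l
      (λ c → trans (count-cong (λ i → left-one i c)) (count-not-R c))
      (λ c → trans (count-cong (λ i → right-one i c)) (count-R c))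

    module _ (F : Square (l ℕ.+ l) 2) (F-columns : ∀ s j → count (λ i → ⌊ F i j Fin.≟ s ⌋) ≡ l)
             (balanced : ∀ c → count (λ i → R c i ∧ ⌊ F i (c ↑ˡ l) Fin.≟ zero ⌋)
                             ≡ count (λ i → R c i ∧ ⌊ F i (l ↑ʳ c) Fin.≟ zero ⌋)) where

      private
        -- Within `R c` the two symbols are complementary, so balance for symbol 0 gives balance for
        -- symbol 1.
        balanced′ : ∀ t c → count (λ i → R c i ∧ ⌊ F i (c ↑ˡ l) Fin.≟ t ⌋)
                          ≡ count (λ i → R c i ∧ ⌊ F i (l ↑ʳ c) Fin.≟ t ⌋)
        balanced′ zero       c = balanced c
        balanced′ (suc zero) c = ℕ.+-cancelˡ-≡ (count (λ i → R c i ∧ ⌊ F i (c ↑ˡ l) Fin.≟ zero ⌋)) _ _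
          (trans (split (c ↑ˡ l)) (trans (sym (split (l ↑ʳ c)))
            (cong (ℕ._+ count (λ i → R c i ∧ ⌊ F i (l ↑ʳ c) Fin.≟ suc zero ⌋)) (sym (balanced c)))))
          where
          split : ∀ j → count (λ i → R c i ∧ ⌊ F i j Fin.≟ zero ⌋) ℕ.+ count (λ i → R c i ∧ ⌊ F i j Fin.≟ suc zero ⌋)
                      ≡ count (R c)
          split j = trans (cong (count (λ i → R c i ∧ ⌊ F i j Fin.≟ zero ⌋) ℕ.+_)
            (count-cong (λ i → cong (R c i ∧_) (one-not-zero (F i j))))) (count-∧-not′ (R c) _)

        -- Symbol `s` of `mate` occupies the rows `R c` of one column and the other rows of its
        -- partner. Balance moves the first count to the partner column, where both make up a full
        -- column with `l` occurrences of `t`.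
        column-pair : ∀ s t c → count (λ i → ⌊ mate i (c ↑ˡ l) Fin.≟ s ⌋ ∧ ⌊ F i (c ↑ˡ l) Fin.≟ t ⌋)
                          ℕ.+ count (λ i → ⌊ mate i (l ↑ʳ c) Fin.≟ s ⌋ ∧ ⌊ F i (l ↑ʳ c) Fin.≟ t ⌋) ≡ l
        column-pair zero t c =
          trans (cong₂ ℕ._+_
            (trans (count-cong (λ i → cong (_∧ _) (left-zero i c))) (balanced′ t c))
            (count-cong (λ i → cong (_∧ _) (right-zero i c))))
          (trans (count-∧-not (R c) (λ i → ⌊ F i (l ↑ʳ c) Fin.≟ t ⌋)) (F-columns t (l ↑ʳ c)))
        column-pair (suc zero) t c =
          trans (ℕ.+-comm (count (λ i → ⌊ mate i (c ↑ˡ l) Fin.≟ suc zero ⌋ ∧ ⌊ F i (c ↑ˡ l) Fin.≟ t ⌋)) _)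
          (trans (cong₂ ℕ._+_
            (trans (count-cong (λ i → cong (_∧ _) (right-one i c))) (sym (balanced′ t c)))
            (count-cong (λ i → cong (_∧ _) (left-one i c))))
          (trans (count-∧-not (R c) (λ i → ⌊ F i (c ↑ˡ l) Fin.≟ t ⌋)) (F-columns t (c ↑ˡ l))))

      -- Each of the `l` column pairs contributes `l`.
      mate-orthogonal : ∀ s t → count2 (λ i j → ⌊ mate i j Fin.≟ s ⌋ ∧ ⌊ F i j Fin.≟ t ⌋) ≡ l * l
      mate-orthogonal s t = trans (count2-transpose (λ i j → both j i))
        (trans (count2-↑ l both) (count2-+ (λ c → both (c ↑ˡ l)) (λ c → both (l ↑ʳ c)) (column-pair s t)))
        where
        both : Fin (l ℕ.+ l) → Fin (l ℕ.+ l) → Bool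
        both j i = ⌊ mate i j Fin.≟ s ⌋ ∧ ⌊ F i j Fin.≟ t ⌋

-- `n` and `d` are variables with equations because `2 * λ′` and its quotient by `λ′` do not reduce
-- to `l + l` and 2.
common-mate : ∀ {k n d l} → 1 ≤ k → 0 < l → 2 * mseq (2 * k) ∣ l → n ≡ l ℕ.+ l → d ≡ 2 →
  (F : Fin k → Square n d) → (∀ a s j → count (λ i → ⌊ F a i j Fin.≟ s ⌋) ≡ l) →
  ∃ λ (L : Square n d) →
    ((∀ s i → count (λ j → ⌊ L i j Fin.≟ s ⌋) ≡ l) × (∀ s j → count (λ i → ⌊ L i j Fin.≟ s ⌋) ≡ l)) ×
    (∀ a s t → count2 (λ i j → ⌊ L i j Fin.≟ s ⌋ ∧ ⌊ F a i j Fin.≟ t ⌋) ≡ l * l)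
common-mate {l = l} 1≤k 0<l dvd refl refl F F-columns =
  mate , (mate-rows , mate-columns (λ c → proj₁ (proj₂ (rows c)))) ,
  λ a → mate-orthogonal (λ c → proj₁ (proj₂ (rows c))) (F a) (F-columns a) (λ c → proj₂ (proj₂ (rows c)) a)
  where
  rows : ∀ c → _
  rows c = half-of-rows 1≤k 0<l dvd
    (λ a i → ⌊ F a i (c ↑ˡ l) Fin.≟ zero ⌋) (λ a i → ⌊ F a i (l ↑ʳ c) Fin.≟ zero ⌋)
    (λ a → trans (F-columns a zero (c ↑ˡ l)) (sym (F-columns a zero (l ↑ʳ c))))
  open Mate (λ c → proj₁ (rows c))

theorem3p1 : (k n : ℕ) → 1 ≤ k → 0 < n → 4 * mseq (2 * k) ∣ n →
    (λ′ : ℕ) .{{_ : NonZero λ′}} → 2 * λ′ ≡ n →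
    ¬ ExistsMaxMOFS k n λ′
theorem3p1 k n 1≤k 0<n dvd λ′ refl (F , F-freq , _ , maximal) = maximal
  (common-mate 1≤k (ℕ.>-nonZero⁻¹ λ′)
    -- `4 m_{2k}` divides `2 * λ′`; cancelling 2 gives the divisibility of the half `λ′`.
    (*-cancelˡ-∣ 2 (subst (_∣ 2 * λ′) (ℕ.*-assoc 2 2 (mseq (2 * k))) dvd))
    (cong (λ′ ℕ.+_) (ℕ.+-identityʳ λ′)) (m*n/n≡m 2 λ′) F (λ a → proj₂ (F-freq a)))
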